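{- For every $k$-terminal digraph $G$ and every pair-set $P\subseteq K\times K$, there exists a reachability-preserving minor $H$ of $G$ with respect to $P$ having $O(k\cdot|P|)$ non-terminal vertices.
   Context: A $k$-terminal digraph is a digraph $G=(V,E)$ with terminal set $K\subset V$, $|K|=k$. A minor of a digraph is obtained by vertex deletions, edge deletions and edge contractions (contracting $(u,v)$ identifies $u$ and $v$, discarding loops), never deleting terminals nor identifying two terminals. For a pair-set $P\subseteq K\times K$, a reachability-preserving minor of $G$ with respect to $P$ is a minor $H$ of $G$ with $K\subseteq V(H)$ such that for every $(s,t)\in P$, $t$ is reachable from $s$ in $H$ iff $t$ is reachable from $s$ in $G$. -}

module Defs where

open import Level using (0ℓ)
open import Data.Nat using (ℕ)
open import Data.Fin using (Fin; _≟_)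
open import Data.Fin.Properties using (any?)
open import Data.Fin.Subset using (Subset; _∈_; _∉_; _⊆_; _─_; _-_; ∣_∣)
open import Data.Fin.Subset.Properties using (x∈p∧x≢y⇒x∈p-y)
open import Data.List using (List; length)
import Data.List.Membership.Propositional as List
open import Data.List.Relation.Unary.Unique.Propositional using (Unique)
open import Data.Product using (_×_; _,_; proj₁; proj₂; ∃₂)
open import Data.Product.Properties using (≡-dec)
open import Function using (_⇔_)
open import Relation.Binary using (Rel; Decidable)
open import Relation.Binary.Construct.Closure.ReflexiveTransitive using (Star)
open import Relation.Binary.PropositionalEquality using (_≡_; _≢_; refl; sym)
open import Relation.Nullary using (yes; no; ¬?; _×-dec_)

-- The vertices are named by elements of Fin n, but the vertex set V may be any
-- subset of Fin n, so that a digraph and its minors share one set of names.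
record Digraph (n : ℕ) : Set₁ where
  field
    V       : Subset n
    Edge    : Rel (Fin n) 0ℓ
    edge?   : Decidable Edge
    source∈ : ∀ {x y} → Edge x y → x ∈ V
    target∈ : ∀ {x y} → Edge x y → y ∈ V

  Reachable : Rel (Fin n) 0ℓ
  Reachable = Star Edge

open Digraph public

record TerminalDigraph (n k : ℕ) : Set₁ where
  field
    graph : Digraph n
    K     : Subset n
    K⊆V   : K ⊆ V graph
    ∣K∣≡k : ∣ K ∣ ≡ k

open TerminalDigraph public

record PairSet {n : ℕ} (K : Subset n) : Set where
  field
    pairs     : List (Fin n × Fin n)
    unique    : Unique pairs
    pairs⊆K×K : ∀ {s t} → (s , t) List.∈ pairs → s ∈ K × t ∈ K

  size : ℕ
  size = length pairs

open PairSet public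

deleteVertex : ∀ {n} → Digraph n → Fin n → Digraph n
deleteVertex G v = record
  { V       = V G - v
  ; Edge    = λ x y → Edge G x y × x ≢ v × y ≢ v
  ; edge?   = λ x y → edge? G x y ×-dec ¬? (x ≟ v) ×-dec ¬? (y ≟ v)
  ; source∈ = λ (e , x≢v , _) → x∈p∧x≢y⇒x∈p-y (source∈ G e) x≢v
  ; target∈ = λ (e , _ , y≢v) → x∈p∧x≢y⇒x∈p-y (target∈ G e) y≢v
  }

deleteEdge : ∀ {n} → Digraph n → Fin n → Fin n → Digraph n
deleteEdge G u v = record
  { V       = V G
  ; Edge    = λ x y → Edge G x y × (x , y) ≢ (u , v)
  ; edge?   = λ x y → edge? G x y ×-dec ¬? (≡-dec _≟_ _≟_ (x , y) (u , v))
  ; source∈ = λ (e , _) → source∈ G e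
  ; target∈ = λ (e , _) → target∈ G e
  }

redirect : ∀ {n} → Fin n → Fin n → Fin n → Fin n
redirect a b x with x ≟ a
... | yes _ = b
... | no  _ = x

redirect∈ : ∀ {n} {p : Subset n} {a b} → b ∈ p → b ≢ a →
            ∀ {x} → x ∈ p → redirect a b x ∈ p - a
redirect∈ {a = a} b∈p b≢a {x} x∈p with x ≟ a
... | yes _   = x∈p∧x≢y⇒x∈p-y b∈p b≢a
... | no  x≢a = x∈p∧x≢y⇒x∈p-y x∈p x≢a

-- The vertex that results from identifying a and b keeps the name b.
identify : ∀ {n} (G : Digraph n) (a b : Fin n) → b ∈ V G → b ≢ a → Digraph n
identify G a b b∈V b≢a = record
  { V       = V G - a
  ; Edge    = λ x y → x ≢ y ×
                (∃₂ λ u v → Edge G u v × redirect a b u ≡ x × redirect a b v ≡ y)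
  ; edge?   = λ x y → ¬? (x ≟ y) ×-dec
                any? λ u → any? λ v →
                  edge? G u v ×-dec redirect a b u ≟ x ×-dec redirect a b v ≟ y
  ; source∈ = λ { (_ , _ , _ , e , refl , _) → redirect∈ b∈V b≢a (source∈ G e) }
  ; target∈ = λ { (_ , _ , _ , e , _ , refl) → redirect∈ b∈V b≢a (target∈ G e) }
  }

-- Contracting an edge is allowed unless both its ends are terminals. The
-- contracted vertex keeps the name of a terminal end if there is one, and hence
-- is itself that terminal in later steps; otherwise it may keep either name.
data MinorStep {n : ℕ} (K : Subset n) (G : Digraph n) : Digraph n → Set where
  delete-vertex   : ∀ {v} → v ∈ V G → v ∉ K → MinorStep K G (deleteVertex G v)
  delete-edge     : ∀ {u v} → Edge G u v → MinorStep K G (deleteEdge G u v)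
  contract-source : ∀ {u v} (e : Edge G u v) (u≢v : u ≢ v) → u ∉ K →
                    MinorStep K G (identify G u v (target∈ G e) (λ v≡u → u≢v (sym v≡u)))
  contract-target : ∀ {u v} (e : Edge G u v) (u≢v : u ≢ v) → v ∉ K →
                    MinorStep K G (identify G v u (source∈ G e) u≢v)

Minor : ∀ {n} → Subset n → Rel (Digraph n) _
Minor K = Star (MinorStep K)

record IsReachabilityPreservingMinor {n k : ℕ} (G : TerminalDigraph n k)
    (P : PairSet (K G)) (H : Digraph n) : Set₁ where
  field
    minor     : Minor (K G) (graph G) H
    terminals : K G ⊆ V H
    preserves : ∀ {s t} → (s , t) List.∈ pairs P →
                Reachable H s t ⇔ Reachable (graph G) s t

nonTerminals : ∀ {n k} → TerminalDigraph n k → Digraph n → Subset n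
nonTerminals G H = V H ─ K G

{-# OPTIONS --safe #-}

-- Delete edges and contract or delete non-terminals as long as all pairs of P keep
-- their reachability. In the resulting H every edge is critical, lying on every walk
-- of some pair of P, and every non-terminal v lies on no cycle and has
-- in-edges a₁ → v and a₂ → v with a₁ ≢ a₂. Let s be the source of a pair for which a₁ → v is critical, and p a pair for
-- which a₂ → v is critical. Then v ↦ (s , p) is injective: if v and w have the same
-- image, a walk of p passes through both, say v first, so that it leads from v to w
-- through b₂ → w. Then s reaches w through v without the edge b₁ → w, although that
-- edge is critical for a pair with source s.
module Submission where

open import Defs
open import Data.Nat using (ℕ; _*_; _≤_; _<_)
import Data.Nat.Properties as ℕ
open import Data.Nat.Induction using (<-wellFounded)
open import Data.Fin using (Fin; zero; suc; _≟_; combine)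
open import Data.Fin.Properties using (any?; all?; combine-injective; injective⇒≤)
import Data.Fin.Properties as Fin
open import Data.Fin.Subset
  using (Subset; inside; outside; _∈_; _∉_; _⊆_; _─_; ∣_∣)
open import Data.Fin.Subset.Properties
  using (_∈?_; x∈p∧x≢y⇒x∈p-y; p─q⊆p; x∈p⇒∣p-x∣<∣p∣)
open import Data.List using (List; []; _∷_; allFin; cartesianProduct)
import Data.List.Membership.Propositional as List
open import Data.List.Membership.Propositional.Properties
  using (∈-allFin; ∈-cartesianProduct⁺)
import Data.List.Membership.Setoid.Properties as Membershipₛ
open import Data.List.Relation.Unary.Any using (here; there; index)
import Data.List.Relation.Unary.Any as Any
open import Data.Product using (∃; ∃-syntax; _×_; _,_; proj₁; proj₂)
open import Data.Product.Properties using (≡-dec)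
open import Data.Sum using (_⊎_; inj₁; inj₂; [_,_]′)
open import Data.Vec using ([]; _∷_; here; there)
open import Function using (_⇔_; mk⇔; Equivalence; Injective; _∘_; id)
open import Function.Construct.Composition using (_⇔-∘_)
open import Function.Construct.Identity using (⇔-id)
open import Induction.WellFounded using (Acc; acc)
open import Relation.Binary using (Decidable)
open import Relation.Binary.Construct.Closure.ReflexiveTransitive
  using (Star; ε; _◅_; _◅◅_; map; return; _⋆; kleisliStar)
open import Relation.Binary.PropositionalEquality
  using (_≡_; _≢_; refl; sym; trans; cong; subst; subst₂; setoid)
open import Relation.Nullary
  using (¬_; Dec; yes; no; ¬?; _×-dec_; _⊎-dec_; _→-dec_; contradiction; map′)
open import Relation.Nullary.Decidable using (decidable-stable)

private variable
  m n : ℕ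

-- Counting subsets

rank : ∀ {p : Subset n} {x} → x ∈ p → Fin ∣ p ∣
rank here                            = zero
rank {p = inside  ∷ _} (there x∈p) = suc (rank x∈p)
rank {p = outside ∷ _} (there x∈p) = rank x∈p

rank-injective : ∀ {p : Subset n} {x y} (x∈p : x ∈ p) (y∈p : y ∈ p) →
                 rank x∈p ≡ rank y∈p → x ≡ y
rank-injective                    here        here        _  = refl
rank-injective {p = inside  ∷ _} (there x∈p) (there y∈p) eq =
  cong suc (rank-injective x∈p y∈p (Fin.suc-injective eq))
rank-injective {p = outside ∷ _} (there x∈p) (there y∈p) eq =
  cong suc (rank-injective x∈p y∈p eq)

element : (p : Subset n) → Fin ∣ p ∣ → ∃ (_∈ p)
element (inside  ∷ p) zero    = zero , here
element (inside  ∷ p) (suc i) with element p i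
... | x , x∈p = suc x , there x∈p
element (outside ∷ p) i       with element p i
... | x , x∈p = suc x , there x∈p

element-injective : (p : Subset n) → Injective _≡_ _≡_ (proj₁ ∘ element p)
element-injective (inside  ∷ p) {zero}  {zero}  _  = refl
element-injective (inside  ∷ p) {suc i} {suc j} eq =
  cong suc (element-injective p (Fin.suc-injective eq))
element-injective (outside ∷ p)                 eq =
  element-injective p (Fin.suc-injective eq)

-- `f` takes the membership proof because a code is built from data available only for members;
-- enumerating `p` by `element` turns it into an injection between finite types.
injective⇒∣p∣≤ : (p : Subset n) (f : ∀ {x} → x ∈ p → Fin m) →
                 (∀ {x y} (x∈p : x ∈ p) (y∈p : y ∈ p) → f x∈p ≡ f y∈p → x ≡ y) →
                 ∣ p ∣ ≤ m
injective⇒∣p∣≤ p f f-injective =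
  injective⇒≤ {f = λ i → f (proj₂ (element p i))}
    λ eq → element-injective p (f-injective _ _ eq)

x∈p─q⇒x∉q : ∀ (p q : Subset n) {x} → x ∈ p ─ q → x ∉ q
x∈p─q⇒x∉q (_ ∷ p) (_       ∷ q) (there x∈p─q) (there x∈q) = x∈p─q⇒x∉q p q x∈p─q x∈q

-- Reachability

Star-last : ∀ {A : Set} {E : A → A → Set} {x y} → Star E x y →
            x ≡ y ⊎ ∃[ z ] Star E x z × E z y
Star-last ε = inj₁ refl
Star-last (e ◅ r) with Star-last r
... | inj₁ refl          = inj₂ (_ , ε , e)
... | inj₂ (z , r′ , e′) = inj₂ (z , e ◅ r′ , e′)

deleteEdge-⊆ : ∀ (G : Digraph n) {u v x y} →
               Reachable (deleteEdge G u v) x y → Reachable G x y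
deleteEdge-⊆ G = map proj₁

-- Cut a walk that uses the edge just before its first use and just after its last use; both
-- remaining pieces avoid the edge.
deleteEdge-split : ∀ (G : Digraph n) u v {x y} → Reachable G x y →
  Reachable (deleteEdge G u v) x y ⊎
  Reachable (deleteEdge G u v) x u × Reachable (deleteEdge G u v) v y
deleteEdge-split G u v ε = inj₁ ε
deleteEdge-split G u v {x} (_◅_ {j = z} e r)
  with ≡-dec _≟_ _≟_ (x , z) (u , v) | deleteEdge-split G u v r
... | yes refl | inj₁ p       = inj₂ (ε , p)
... | yes refl | inj₂ (_ , q) = inj₂ (ε , q)
... | no  e≢uv | inj₁ p       = inj₁ ((e , e≢uv) ◅ p)
... | no  e≢uv | inj₂ (p , q) = inj₂ ((e , e≢uv) ◅ p , q)

-- After its last use of the edge, a walk would lead from `v` to `y`.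
avoid : ∀ (G : Digraph n) u v {x y} → Reachable G x y → ¬ Reachable G v y →
        Reachable (deleteEdge G u v) x y
avoid G u v r v↛y with deleteEdge-split G u v r
... | inj₁ p       = p
... | inj₂ (_ , q) = contradiction (deleteEdge-⊆ G q) v↛y

-- Recursion on a list containing all edges: once `u → v` is removed, `deleteEdge-split` reduces the
-- question to three questions about the smaller digraph.
reachable?-within : (L : List (Fin n × Fin n)) (G : Digraph n) →
                    (∀ {x y} → Edge G x y → (x , y) List.∈ L) → Decidable (Reachable G)
reachable?-within [] G E⊆L x y = map′ (λ { refl → ε }) only-ε (x ≟ y)
  where
  only-ε : Reachable G x y → x ≡ y
  only-ε ε = refl
  only-ε (e ◅ _) with () ← E⊆L e
reachable?-within {n} ((u , v) ∷ L) G E⊆L x y with edge? G u v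
... | no ¬uv = reachable?-within L G E⊆L′ x y
  where
  E⊆L′ : ∀ {x y} → Edge G x y → (x , y) List.∈ L
  E⊆L′ e with E⊆L e
  ... | here refl = contradiction e ¬uv
  ... | there i   = i
... | yes uv = map′ join (deleteEdge-split G u v) (x ⇝? y ⊎-dec x ⇝? u ×-dec v ⇝? y)
  where
  E⊆L′ : ∀ {x y} → Edge (deleteEdge G u v) x y → (x , y) List.∈ L
  E⊆L′ (e , e≢uv) with E⊆L e
  ... | here eq = contradiction eq e≢uv
  ... | there i = i

  _⇝?_ : Decidable (Reachable (deleteEdge G u v))
  _⇝?_ = reachable?-within L (deleteEdge G u v) E⊆L′

  join : Reachable (deleteEdge G u v) x y ⊎
         Reachable (deleteEdge G u v) x u × Reachable (deleteEdge G u v) v y →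
         Reachable G x y
  join (inj₁ p)       = deleteEdge-⊆ G p
  join (inj₂ (p , q)) = deleteEdge-⊆ G p ◅◅ uv ◅ deleteEdge-⊆ G q

allPairs : ∀ n → List (Fin n × Fin n)
allPairs n = cartesianProduct (allFin n) (allFin n)

∈-allPairs : ∀ (x y : Fin n) → (x , y) List.∈ allPairs n
∈-allPairs x y = ∈-cartesianProduct⁺ (∈-allFin x) (∈-allFin y)

reachable? : (G : Digraph n) → Decidable (Reachable G)
reachable? {n} G = reachable?-within (allPairs n) G λ _ → ∈-allPairs _ _

-- A walk starting elsewhere can visit `v` only by entering it, which needs an in-edge.
deleteVertex-reachable : ∀ (G : Digraph n) {v} → (∀ u → ¬ Edge G u v) →
  ∀ {x y} → x ≢ v → Reachable G x y → Reachable (deleteVertex G v) x y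
deleteVertex-reachable G no-in x≢v ε       = ε
deleteVertex-reachable G no-in x≢v (e ◅ r) =
  (e , x≢v , z≢v) ◅ deleteVertex-reachable G no-in z≢v r
  where z≢v = λ { refl → no-in _ e }

redirect-≢ : ∀ {a b x : Fin n} → x ≢ a → redirect a b x ≡ x
redirect-≢ {a = a} {x = x} x≢a with x ≟ a
... | yes x≡a = contradiction x≡a x≢a
... | no  _   = refl

module _ (G : Digraph n) {v a : Fin n} (a∈V : a ∈ V G) (a≢v : a ≢ v) where

  private G/ = identify G v a a∈V a≢v

  identify-reachable : ∀ {x y} → Reachable G x y →
                       Reachable G/ (redirect v a x) (redirect v a y)
  identify-reachable = kleisliStar (redirect v a) step
    where
    step : ∀ {x y} → Edge G x y → Reachable G/ (redirect v a x) (redirect v a y)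
    step {x} {y} e with redirect v a x ≟ redirect v a y
    -- The edge has become a loop, which `identify` discards, so the empty walk replaces it.
    ... | yes eq = subst (Reachable G/ _) eq ε
    ... | no ≢   = return (≢ , x , y , e , refl , refl)

  -- Each new edge lifts to a walk: `a → w` coming from `v → w` is `a → v → w`, and `u → a` coming
  -- from `u → v` is the assumed walk from `u` to `a`.
  identify-reachable⁻ : Edge G a v → (∀ u → Edge G u v → Reachable G u a) →
                        ∀ {x y} → Reachable G/ x y → Reachable G x y
  identify-reachable⁻ av in⇝a = step ⋆
    where
    step : ∀ {x y} → Edge G/ x y → Reachable G x y
    step (x≢y , u , w , e , eq₁ , eq₂) with u ≟ v | w ≟ v | eq₁ | eq₂
    ... | yes refl | yes _    | refl | refl = contradiction refl x≢y
    ... | yes refl | no  _    | refl | refl = av ◅ return e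
    ... | no  _    | yes refl | refl | refl = in⇝a u e
    ... | no  _    | no  _    | refl | refl = return e

-- Irreducible minors

MinorStep-⊆ : ∀ {K : Subset n} {G H} → MinorStep K G H → K ⊆ V G → K ⊆ V H
MinorStep-⊆ (delete-vertex _ v∉K)       K⊆V x∈K = x∈p∧x≢y⇒x∈p-y (K⊆V x∈K) λ { refl → v∉K x∈K }
MinorStep-⊆ (delete-edge _)             K⊆V x∈K = K⊆V x∈K
MinorStep-⊆ (contract-source _ _ u∉K)   K⊆V x∈K = x∈p∧x≢y⇒x∈p-y (K⊆V x∈K) λ { refl → u∉K x∈K }
MinorStep-⊆ (contract-target _ _ v∉K)   K⊆V x∈K = x∈p∧x≢y⇒x∈p-y (K⊆V x∈K) λ { refl → v∉K x∈K }

Minor-⊆ : ∀ {K : Subset n} {G H} → Minor K G H → K ⊆ V G → K ⊆ V H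
Minor-⊆ ε       K⊆V = K⊆V
Minor-⊆ (s ◅ r) K⊆V = Minor-⊆ r (MinorStep-⊆ s K⊆V)

module _ {n : ℕ} {K : Subset n} (P : PairSet K) where

  Preserves : Digraph n → Digraph n → Set
  Preserves G H = ∀ {s t} → (s , t) List.∈ pairs P → Reachable H s t ⇔ Reachable G s t

  Preserves-refl : ∀ {G} → Preserves G G
  Preserves-refl _ = ⇔-id _

  Preserves-trans : ∀ {G H I} → Preserves G H → Preserves H I → Preserves G I
  Preserves-trans G~H H~I i = G~H i ⇔-∘ H~I i

  -- There is a walk from `s` to `t`, and all such walks use the edge.
  CriticalFor : Digraph n → (u v : Fin n) → Fin n × Fin n → Set
  CriticalFor G u v (s , t) = Reachable G s t × ¬ Reachable (deleteEdge G u v) s t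

  Critical : Digraph n → (u v : Fin n) → Set
  Critical G u v = ∃[ p ] p List.∈ pairs P × CriticalFor G u v p

  critical? : ∀ G u v → Dec (Critical G u v)
  critical? G u v = map′ List.find (λ (_ , i , c) → List.lose i c)
    (Any.any? (λ (s , t) → reachable? G s t ×-dec ¬? (reachable? (deleteEdge G u v) s t))
      (pairs P))

  ¬Critical⇒Preserves : ∀ {G u v} → ¬ Critical G u v → Preserves G (deleteEdge G u v)
  ¬Critical⇒Preserves {G} {u} {v} ¬c {s} {t} i = mk⇔ (deleteEdge-⊆ G)
    λ r → decidable-stable (reachable? (deleteEdge G u v) s t) λ ¬r → ¬c (_ , i , r , ¬r)

  -- Edges already found critical stay so under later deletions, so one pass over the edges suffices
  -- for trimming.
  Critical-deleteEdge : ∀ {G u v x y} → ¬ Critical G u v →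
                        Critical G x y → Critical (deleteEdge G u v) x y
  Critical-deleteEdge {G} ¬c (p , i , r , ¬r) =
    p , i , Equivalence.from (¬Critical⇒Preserves {G} ¬c i) r ,
    ¬r ∘ map λ ((e , _) , ≢xy) → e , ≢xy

  Reduct : Digraph n → (Digraph n → Set) → Set₁
  Reduct G Q = ∃[ H ] Minor K G H × Preserves G H × Q H

  AllCritical : Digraph n → Set
  AllCritical G = ∀ {x y} → Edge G x y → Critical G x y

  -- Invariant: `L` contains every edge whose criticality is not yet established.
  trim-within : ∀ L G → (∀ {x y} → Edge G x y → (x , y) List.∈ L ⊎ Critical G x y) →
                Reduct G λ H → V H ≡ V G × AllCritical H
  trim-within [] G E⊆ = G , ε , Preserves-refl {G} , refl , λ e → [ (λ ()) , id ]′ (E⊆ e)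
  trim-within ((u , v) ∷ L) G E⊆ with edge? G u v | critical? G u v
  ... | no ¬uv | _ = trim-within L G E⊆′
    where
    E⊆′ : ∀ {x y} → Edge G x y → (x , y) List.∈ L ⊎ Critical G x y
    E⊆′ e with E⊆ e
    ... | inj₁ (here refl) = contradiction e ¬uv
    ... | inj₁ (there i)   = inj₁ i
    ... | inj₂ c           = inj₂ c
  ... | yes _ | yes c = trim-within L G E⊆′
    where
    E⊆′ : ∀ {x y} → Edge G x y → (x , y) List.∈ L ⊎ Critical G x y
    E⊆′ e with E⊆ e
    ... | inj₁ (here refl) = inj₂ c
    ... | inj₁ (there i)   = inj₁ i
    ... | inj₂ c′          = inj₂ c′
  ... | yes uv | no ¬c = extend (trim-within L (deleteEdge G u v) E⊆′)
    where
    E⊆′ : ∀ {x y} → Edge (deleteEdge G u v) x y →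
          (x , y) List.∈ L ⊎ Critical (deleteEdge G u v) x y
    E⊆′ (e , e≢uv) with E⊆ e
    ... | inj₁ (here eq) = contradiction eq e≢uv
    ... | inj₁ (there i) = inj₁ i
    ... | inj₂ c         = inj₂ (Critical-deleteEdge {G} ¬c c)

    extend : Reduct (deleteEdge G u v) (λ H → V H ≡ V G × AllCritical H) →
             Reduct G (λ H → V H ≡ V G × AllCritical H)
    extend (H , minor , G-uv~H , q) =
      H , delete-edge uv ◅ minor ,
      Preserves-trans {G} {deleteEdge G u v} {H} (¬Critical⇒Preserves {G} ¬c) G-uv~H , q

  trim : ∀ G → Reduct G λ H → V H ≡ V G × AllCritical H
  trim G = trim-within (allPairs n) G λ _ → inj₁ (∈-allPairs _ _)

  -- Removing non-terminals by deletion and contraction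

  Sourceless : Digraph n → Fin n → Set
  Sourceless G v = v ∈ V G × v ∉ K × ∀ u → ¬ Edge G u v

  sourceless? : ∀ G v → Dec (Sourceless G v)
  sourceless? G v = v ∈? V G ×-dec ¬? (v ∈? K) ×-dec all? λ u → ¬? (edge? G u v)

  -- The last condition ensures that merging `v` into `a` creates no new reachability: whatever
  -- enters `v` could already reach `a`.
  Contractible : Digraph n → Fin n → Fin n → Set
  Contractible G a v =
    Edge G a v × v ∉ K × a ≢ v × ∀ u → Edge G u v → Reachable G u a

  contractible? : ∀ G a v → Dec (Contractible G a v)
  contractible? G a v = edge? G a v ×-dec ¬? (v ∈? K) ×-dec ¬? (a ≟ v) ×-dec
    all? λ u → edge? G u v →-dec reachable? G u a

  record Irreducible (G : Digraph n) : Set where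
    field
      critical       : AllCritical G
      ¬sourceless    : ∀ v → ¬ Sourceless G v
      ¬contractible  : ∀ a v → ¬ Contractible G a v

  Smaller : Digraph n → Set₁
  Smaller G = ∃[ H ] MinorStep K G H × Preserves G H × ∣ V H ∣ < ∣ V G ∣

  deleteSourceless : ∀ {G v} → Sourceless G v → Smaller G
  deleteSourceless {G} {v} (v∈V , v∉K , no-in) =
    deleteVertex G v , delete-vertex v∈V v∉K ,
    (λ i → mk⇔ (map proj₁)
      (deleteVertex-reachable G no-in λ { refl → v∉K (proj₁ (pairs⊆K×K P i)) })) ,
    x∈p⇒∣p-x∣<∣p∣ v∈V

  contract : ∀ {G a v} → Contractible G a v → Smaller G
  contract {G} {a} {v} (av , v∉K , a≢v , in⇝a) =
    identify G v a (source∈ G av) a≢v , contract-target av a≢v v∉K ,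
    (λ i → let s∈K , t∈K = pairs⊆K×K P i in
      mk⇔ (identify-reachable⁻ G (source∈ G av) a≢v av in⇝a)
        λ r → subst₂ (Reachable (identify G v a (source∈ G av) a≢v))
                (fixed s∈K) (fixed t∈K) (identify-reachable G (source∈ G av) a≢v r)) ,
    x∈p⇒∣p-x∣<∣p∣ (target∈ G av)
    where
    fixed : ∀ {x} → x ∈ K → redirect v a x ≡ x
    fixed x∈K = redirect-≢ λ { refl → v∉K x∈K }

  irreducible-or-smaller : ∀ {G} → AllCritical G → Irreducible G ⊎ Smaller G
  irreducible-or-smaller {G} critical
    with any? (sourceless? G) | any? (λ a → any? (contractible? G a))
  ... | yes (_ , c) | _               = inj₂ (deleteSourceless c)
  ... | no  _       | yes (_ , _ , c) = inj₂ (contract c)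
  ... | no  ¬s      | no  ¬c          = inj₁ record
    { critical      = critical
    ; ¬sourceless   = λ v s → ¬s (v , s)
    ; ¬contractible = λ a v c → ¬c (a , v , c)
    }

  -- Each round trims and then removes a vertex if possible. Trimming leaves the vertex set
  -- unchanged, so the number of vertices drops from round to round.
  reduce : ∀ G → Reduct G Irreducible
  reduce G = go G (<-wellFounded ∣ V G ∣)
    where
    go : ∀ G → Acc _<_ ∣ V G ∣ → Reduct G Irreducible
    go G (acc rec) with trim G
    ... | H , G→H , G~H , V≡ , critical with irreducible-or-smaller {H} critical
    ...   | inj₁ irr = H , G→H , G~H , irr
    ...   | inj₂ (I , H→I , H~I , I<H)
            with go I (rec (subst (λ W → ∣ V I ∣ < ∣ W ∣) V≡ I<H))
    ...     | J , I→J , I~J , irr =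
      J , G→H ◅◅ H→I ◅ I→J ,
      Preserves-trans {G} {H} {J} G~H (Preserves-trans {H} {I} {J} H~I I~J) , irr

  -- Counting the non-terminals of an irreducible minor

  module _ {H : Digraph n} (irr : Irreducible H) where
    open Irreducible irr

    -- If `v` reached `a`, every in-neighbour of `v` would reach `a` through `v`, making `a → v`
    -- contractible unless it is a loop.
    acyclic : ∀ {v} → v ∉ K → ∀ {a} → Edge H a v → ¬ Reachable H v a
    acyclic {v} v∉K {a} av v⇝a with a ≟ v
    ... | no a≢v = ¬contractible a v (av , v∉K , a≢v , λ u uv → uv ◅ v⇝a)
    -- A loop can be cut out of any walk, so it is not critical.
    ... | yes refl with critical av
    ...   | _ , _ , r , ¬r with deleteEdge-split H v v r
    ...     | inj₁ p       = ¬r p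
    ...     | inj₂ (p , q) = ¬r (p ◅◅ q)

    antisym : ∀ {v w} → w ∉ K → Reachable H v w → Reachable H w v → v ≡ w
    antisym w∉K v⇝w w⇝v with Star-last v⇝w
    ... | inj₁ v≡w            = v≡w
    ... | inj₂ (b , v⇝b , bw) = contradiction (w⇝v ◅◅ v⇝b) (acyclic w∉K bw)

    record InEdges (v : Fin n) : Set where
      field
        a₁ a₂     : Fin n
        a₁≢a₂     : a₁ ≢ a₂
        edge₁     : Edge H a₁ v
        edge₂     : Edge H a₂ v

      critical₁ = critical edge₁
      critical₂ = critical edge₂

    -- Some `a → v` exists since `v` is not sourceless. As that edge is not contractible, another
    -- in-neighbour `u` fails to reach `a`, whence `u ≢ a`.
    inEdges : ∀ {v} → v ∈ V H → v ∉ K → InEdges v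
    inEdges {v} v∈V v∉K with any? (λ a → edge? H a v)
    ... | no no-in = contradiction (v∈V , v∉K , λ u uv → no-in (u , uv)) (¬sourceless v)
    ... | yes (a , av) with any? (λ u → edge? H u v ×-dec ¬? (reachable? H u a))
    ...   | yes (u , uv , ¬u⇝a) = record
      { a₁≢a₂ = λ { refl → ¬u⇝a ε } ; edge₁ = av ; edge₂ = uv }
    ...   | no  all⇝a = contradiction
      ( av , v∉K , (λ { refl → acyclic v∉K av ε })
      , λ u uv → decidable-stable (reachable? H u a) λ ¬u⇝a → all⇝a (u , uv , ¬u⇝a))
      (¬contractible a v)

    critical-source : ∀ {u v s t} → CriticalFor H u v (s , t) → Reachable H s u
    critical-source {u} {v} (r , ¬r) with deleteEdge-split H u v r
    ... | inj₁ p       = contradiction p ¬r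
    ... | inj₂ (p , _) = deleteEdge-⊆ H p

    critical-target : ∀ {u v s t} → CriticalFor H u v (s , t) →
                      Reachable (deleteEdge H u v) v t
    critical-target {u} {v} (r , ¬r) with deleteEdge-split H u v r
    ... | inj₁ p       = contradiction p ¬r
    ... | inj₂ (_ , q) = q

    -- A walk of p uses both edges, and uses the edge into v first as w does not reach v.
    enters-through : ∀ {a v b w p} → Edge H a v → CriticalFor H a v p →
      CriticalFor H b w p → ¬ Reachable H w v → Reachable H v b
    enters-through {b = b} {w} av c (_ , ¬r) w↛v
      with deleteEdge-split H b w (deleteEdge-⊆ H (critical-target c))
    ... | inj₁ v⇝t       = contradiction
      (avoid H b w (critical-source c ◅◅ return av) w↛v ◅◅ v⇝t) ¬r
    ... | inj₂ (v⇝b , _) = deleteEdge-⊆ H v⇝b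

    -- Assuming `w` does not reach `v` fixes the order in which a walk of the shared pair visits
    -- them: `v` first. The opposite order is covered by exchanging `v` and `w`.
    same-code⇒¬¬reachable : ∀ {v w} → w ∉ K → (I : InEdges v) (J : InEdges w) →
      let open InEdges in
      proj₁ (proj₁ (critical₁ I)) ≡ proj₁ (proj₁ (critical₁ J)) →
      proj₁ (critical₂ I) ≡ proj₁ (critical₂ J) →
      ¬ ¬ Reachable H w v
    same-code⇒¬¬reachable {v} {w} w∉K I J s≡ p≡ w↛v =
      -- Joined with the tail of a walk after its last use of `b₁ → w`, the detour to `w` connects a
      -- pair for which that edge is critical without using it.
      proj₂ d₁ (subst (λ s → Reachable (deleteEdge H b₁ w) s _) s≡ s⇝w
        ◅◅ critical-target d₁)
      where
      open InEdges I using (edge₁; edge₂; critical₁; critical₂)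
      open InEdges J using () renaming
        (a₁ to b₁; a₂ to b₂; a₁≢a₂ to b₁≢b₂; edge₂ to b₂w;
         critical₁ to critical₁′; critical₂ to critical₂′)
      c₁ = proj₂ (proj₂ critical₁)
      c₂ = proj₂ (proj₂ critical₂)
      d₁ = proj₂ (proj₂ critical₁′)
      d₂ = proj₂ (proj₂ critical₂′)

      v⇝b₂ : Reachable H v b₂
      v⇝b₂ = enters-through edge₂ c₂ (subst (CriticalFor H b₂ w) (sym p≡) d₂) w↛v

      s⇝w : Reachable (deleteEdge H b₁ w) (proj₁ (proj₁ critical₁)) w
      -- Using `b₁ → w` before `v` would let `w` reach `v`; using it between `v` and `b₂` would
      -- close a cycle through `w`. The final edge differs from it since `b₁ ≢ b₂`.
      s⇝w = avoid H b₁ w (critical-source c₁ ◅◅ return edge₁) w↛v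
         ◅◅ avoid H b₁ w v⇝b₂ (acyclic w∉K b₂w)
         ◅◅ return (b₂w , λ eq → b₁≢b₂ (sym (cong proj₁ eq)))

    -- Equality of vertices is decidable, so the double negations are harmless: `v` and `w` reach
    -- each other, and no cycle passes through a non-terminal.
    same-code⇒≡ : ∀ {v w} → v ∉ K → w ∉ K → (I : InEdges v) (J : InEdges w) →
      let open InEdges in
      proj₁ (proj₁ (critical₁ I)) ≡ proj₁ (proj₁ (critical₁ J)) →
      proj₁ (critical₂ I) ≡ proj₁ (critical₂ J) →
      v ≡ w
    same-code⇒≡ {v} {w} v∉K w∉K I J s≡ p≡ = decidable-stable (v ≟ w) λ v≢w →
      same-code⇒¬¬reachable w∉K I J s≡ p≡ λ w⇝v →
      same-code⇒¬¬reachable v∉K J I (sym s≡) (sym p≡) λ v⇝w →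
      v≢w (antisym w∉K v⇝w w⇝v)

    -- The code pairs a terminal, by its rank in `K`, with a position in the list of pairs.
    irreducible-bound : ∣ V H ─ K ∣ ≤ ∣ K ∣ * size P
    irreducible-bound = injective⇒∣p∣≤ (V H ─ K) code code-injective
      where
      ∉K : ∀ {v} → v ∈ V H ─ K → v ∉ K
      ∉K = x∈p─q⇒x∉q (V H) K

      ins : ∀ {v} → v ∈ V H ─ K → InEdges v
      ins v∈ = inEdges (p─q⊆p (V H) K v∈) (∉K v∈)

      source∈K : ∀ {v} (I : InEdges v) → proj₁ (proj₁ (InEdges.critical₁ I)) ∈ K
      source∈K I = proj₁ (pairs⊆K×K P (proj₁ (proj₂ (InEdges.critical₁ I))))

      sourceRank : ∀ {v} → InEdges v → Fin ∣ K ∣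
      sourceRank I = rank (source∈K I)

      pairIndex : ∀ {v} → InEdges v → Fin (size P)
      pairIndex I = index (proj₁ (proj₂ (InEdges.critical₂ I)))

      code : ∀ {v} → v ∈ V H ─ K → Fin (∣ K ∣ * size P)
      code v∈ = combine (sourceRank (ins v∈)) (pairIndex (ins v∈))

      code-injective : ∀ {v w} (v∈ : v ∈ V H ─ K) (w∈ : w ∈ V H ─ K) →
                       code v∈ ≡ code w∈ → v ≡ w
      code-injective v∈ w∈ eq
        with s≡ , p≡ ← combine-injective (sourceRank (ins v∈)) _ (sourceRank (ins w∈)) _ eq =
        same-code⇒≡ (∉K v∈) (∉K w∈) (ins v∈) (ins w∈)
          (rank-injective (source∈K (ins v∈)) (source∈K (ins w∈)) s≡)
          (Membershipₛ.index-injective (setoid _) _ _ p≡)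

mainTheorem7 : ∃[ C ] (∀ (n k : ℕ) (G : TerminalDigraph n k) (P : PairSet (K G)) →
    ∃[ H ] (IsReachabilityPreservingMinor G P H ×
    ∣ nonTerminals G H ∣ ≤ C * (k * size P)))
-- The code count is exactly `∣ K ∣ * size P`, so the constant 1 suffices.
mainTheorem7 = 1 , λ n k G P →
  let H , minor , G~H , irr = reduce P (graph G) in
  H ,
  record { minor = minor ; terminals = Minor-⊆ minor (K⊆V G) ; preserves = G~H } ,
  subst (∣ nonTerminals G H ∣ ≤_)
    (trans (cong (_* size P) (∣K∣≡k G)) (sym (ℕ.*-identityˡ _)))
    (irreducible-bound P irr)
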